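{- Let $\phi:\mathbb{N}\to\mathbb{N}$ be any function. For any instance oracle $f$ with $\max\{|f(G,v)|: G \text{ an } n\text{ -node graph}, v\in G\}=o(n\phi(n))$ and any deterministic exploration algorithm $A$, there exist a constant $c>0$ and infinitely many $n$ such that for each of them there are an $n$-node graph $G$ and a starting node $v$ for which the agent executing $A$ with input $f(G,v)$ from $v$ does not explore $G$ within fewer than $c\, n^2/2^{\phi(n)}$ edge traversals. That is, exploration takes time $\Omega(n^2/2^{\phi(n)})$ on some $n$-node graph, for arbitrarily large $n$.
   Context: Model: a graph is a simple connected undirected graph with $n$ nodes. Nodes are unlabeled; at each node of degree $d$ the incident edges carry distinct port numbers $0,\dots,d-1$, arbitrarily assigned. A mobile agent starts at some node. At each step, located at a node $u$ whose degree it knows, it chooses a port at $u$ and traverses the corresponding edge to a neighbor $w$; upon arrival it learns the port number of this edge at $w$ and the degree of $w$. The agent must visit all nodes and stop; the time of exploration is the number of edge traversals. A deterministic exploration algorithm receives as input a binary string (advice); its size is its length. An instance oracle is a function assigning a binary string $f(G,v)$ to each pair $(G,v)$ where $G$ is a port-numbered graph and $v$ is the starting node of the agent in $G$. -}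

module Defs where

open import Data.Bool.Base using (Bool)
open import Data.Fin.Base using (Fin)
open import Data.Integer.Base using (+_)
open import Data.List.Base using (List; length)
open import Data.Maybe.Base using (Maybe; just; nothing)
open import Data.Nat.Base using (ℕ; zero; suc; _≤_)
open import Data.Product.Base using (Σ; ∃; ∃-syntax; _×_; _,_; proj₁; proj₂)
open import Data.Rational.Unnormalised.Base as ℚᵘ using (ℚᵘ; 0ℚᵘ)
open import Function.Definitions using (Injective)
open import Relation.Binary.Construct.Closure.ReflexiveTransitive using (Star)
open import Relation.Binary.Definitions using (Symmetric)
open import Relation.Binary.PropositionalEquality.Core using (_≡_; refl)
open import Relation.Nullary.Negation.Core using (¬_)

-- Simple connected undirected graphs with port numbers: nbr v lists the
-- neighbours of v in the order of the ports at v.  Injectivity of nbr v rules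
-- out parallel edges and makes deg v the degree of v.  The elements of Fin n
-- only serve to name the nodes; agents have no access to them.
record PortGraph (n : ℕ) : Set where
  field
    deg : Fin n → ℕ
    nbr : (v : Fin n) → Fin (deg v) → Fin n

  Adj : Fin n → Fin n → Set
  Adj v w = ∃[ p ] nbr v p ≡ w

  field
    nbr-injective : ∀ v → Injective _≡_ _≡_ (nbr v)
    irreflexive   : ∀ {v} → ¬ Adj v v
    symmetric     : Symmetric Adj
    connected     : ∀ u v → Star Adj u v

  -- The port at the other endpoint of the edge with port p at v
  -- (unique, by injectivity).
  backPort : (v : Fin n) (p : Fin (deg v)) → Fin (deg (nbr v p))
  backPort v p = proj₁ (symmetric (p , refl))

open PortGraph public

-- Everything an agent has learned so far, indexed by the degree of its current
-- node: the degree of the starting node and, for each traversal, the port taken,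
-- the degree of the node reached and the port of arrival there.
data History : ℕ → Set where
  start : (d : ℕ) → History d
  step  : ∀ {d} → History d → Fin d → (d′ : ℕ) → Fin d′ → History d′

Advice : Set
Advice = List Bool

-- The result nothing means that the agent stops.
Algorithm : Set
Algorithm = Advice → ∀ {d} → History d → Maybe (Fin d)

Oracle : Set
Oracle = ∀ {n} → PortGraph n → Fin n → Advice

module _ {n : ℕ} (A : Algorithm) (s : Advice) (G : PortGraph n) where

  Config : Set
  Config = Σ (Fin n) (λ u → History (deg G u))

  act : (c : Config) → Maybe (Fin (deg G (proj₁ c))) → Config
  act c       nothing  = c
  act (u , h) (just p) = nbr G u p , step h p (deg G (nbr G u p)) (backPort G u p)

  -- After min(k , number of traversals before stopping) traversals.
  config : Fin n → ℕ → Config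
  config v zero    = v , start (deg G v)
  config v (suc k) = act (config v k) (A s (proj₂ (config v k)))

  position : Fin n → ℕ → Fin n
  position v k = proj₁ (config v k)

  StoppedBy : Fin n → ℕ → Set
  StoppedBy v t = A s (proj₂ (config v t)) ≡ nothing

  VisitsAllBy : Fin n → ℕ → Set
  VisitsAllBy v t = ∀ w → ∃[ k ] k ≤ t × position v k ≡ w

  -- Exploration means visiting all nodes and stopping; here using at most
  -- t edge traversals.
  ExploresWithin : Fin n → ℕ → Set
  ExploresWithin v t = VisitsAllBy v t × StoppedBy v t

fromℕ : ℕ → ℚᵘ
fromℕ m = + m ℚᵘ./ 1

-- max { |f(G,v)| : G an n-node graph, v ∈ G } = o(g(n)), where a maximum is
-- bounded by x iff all its members are; rational ε suffice.
AdviceSize-o : Oracle → (ℕ → ℕ) → Set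
AdviceSize-o f g =
  ∀ (ε : ℚᵘ) → 0ℚᵘ ℚᵘ.< ε →
  ∃[ N ] ∀ n → N ≤ n → ∀ (G : PortGraph n) (v : Fin n) →
  fromℕ (length (f G v)) ℚᵘ.≤ ε ℚᵘ.* fromℕ (g n)

{-# OPTIONS --safe #-}
module Submission where

-- In K_{m,m} subdivide, for every left node i, one edge at i, leading to the right node
-- x i.  All these graphs have n = 3m nodes and look alike except for the new nodes, so the
-- agent's whole walk, and x itself once all new nodes are found, is determined by the
-- advice and by the set of those times at which a new node is first reached.  Within
-- q m steps this set has at most m elements, which leaves at most (4q)^m possibilities;
-- with advice of at most m φ(n) bits, fewer than 2 (4q 2^φ(n))^m of the m^m codes x can be
-- handled.  This is at most m^m for q = ⌊m / (8 2^φ(n))⌋.  If that q is 0, the bound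
-- already follows from the 3m - 1 steps needed to visit all nodes.

open import Data.Bool.Base using (Bool; true; false; not)
import Data.Bool.Properties as Bool
open import Data.Fin.Base using (Fin; zero; suc; fromℕ<; combine; finToFun; funToFin)
open import Data.Fin.Patterns using (0F; 1F; 2F)
open import Data.Fin.Properties as Fin
  using (_≟_; *↔×; all?; ¬∀⟶∃¬; injective⇒≤; funToFin-finToFin; fromℕ<-injective; combine-injective)
open import Data.Fin.Subset using (Subset; ⊥; inside; outside; ∣_∣)
open import Data.Fin.Subset.Properties using (∣p∣≤n; ∣⊥∣≡0)
open import Data.Integer.Base as ℤ using (+_)
import Data.Integer.Properties as ℤ
open import Data.List.Base as List using (List; []; _∷_; _++_; length)
open import Data.List.Membership.Propositional using (_∈_)
open import Data.List.Membership.Propositional.Properties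
  using (∈-map⁺; ∈-++⁺ˡ; ∈-++⁺ʳ)
open import Data.List.Properties using (length-map; length-++)
open import Data.List.Relation.Unary.Any using (here; there; index)
open import Data.List.Relation.Unary.Any.Properties using (lookup-index)
open import Data.Maybe.Base using (Maybe; just; nothing)
open import Data.Nat.Base
  using (ℕ; zero; suc; _≤_; _<_; _+_; _*_; _^_; _/_; _%_; z≤n; s≤s; _≤′_; ≤′-refl; ≤′-step;
         NonZero; ≢-nonZero⁻¹)
open import Data.Nat.DivMod using (m/n*n≤m; m≡m%n+[m/n]*n; m%n≤n)
open import Data.Nat.Properties hiding (_≟_)
open import Data.Nat.Tactic.RingSolver using (solve-∀)
open import Data.Product.Base using (Σ; Σ-syntax; ∃-syntax; _×_; _,_; proj₁; proj₂)
open import Data.Rational.Unnormalised.Base as ℚᵘ using (ℚᵘ; 0ℚᵘ)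
open import Data.Vec.Base using (Vec; []; _∷_; lookup; _[_]≔_)
open import Data.Vec.Properties
  using (lookup∘update; lookup∘update′; lookup-replicate; ∷-injectiveˡ; ∷-injectiveʳ)
open import Function.Base using (_∘_)
open import Function.Bundles using (_↔_; Inverse)
open import Function.Definitions using (Injective)
open import Relation.Binary.Construct.Closure.ReflexiveTransitive
  using (Star; ε; _◅_; _◅◅_; gmap; reverse)
open import Relation.Binary.Definitions using (Symmetric)
open import Relation.Binary.PropositionalEquality
  using (_≡_; _≢_; _≗_; refl; sym; trans; cong; cong₂; subst; subst₂)
open import Relation.Nullary using (yes; no)
open import Relation.Nullary.Negation using (¬_; contradiction)
open import Defs

-- Port-numbered graphs and walks from rotation systems.

-- A graph given by its darts (half-edges) and the involution pairing the two
-- darts of each edge.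
record RotationSystem (V : Set) : Set where
  field
    degree : V → ℕ

  Dart : Set
  Dart = Σ V (Fin ∘ degree)

  field
    opposite : Dart → Dart

  neighbour : ∀ v → Fin (degree v) → V
  neighbour v p = proj₁ (opposite (v , p))

  Edge : V → V → Set
  Edge v w = ∃[ p ] neighbour v p ≡ w

  field
    opposite-involutive : ∀ e → opposite (opposite e) ≡ e
    neighbour-injective : ∀ v → Injective _≡_ _≡_ (neighbour v)
    edge-irreflexive    : ∀ {v} → ¬ Edge v v
    edge-connected      : ∀ v w → Star Edge v w

module _ {V : Set} {n : ℕ} (Fin↔V : Fin n ↔ V) (R : RotationSystem V) where
  open Inverse Fin↔V using (strictlyInverseˡ; strictlyInverseʳ)
    renaming (to to node; from to name)
  open RotationSystem R

  private
    rebase : ∀ (e : Dart) {v} (eq : proj₁ e ≡ v) →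
             (v , subst (Fin ∘ degree) eq (proj₂ e)) ≡ e
    rebase e refl = refl

  portGraph : PortGraph n
  portGraph .deg = degree ∘ node
  portGraph .nbr v p = name (neighbour (node v) p)
  portGraph .nbr-injective v eq = neighbour-injective (node v)
    (trans (sym (strictlyInverseˡ _)) (trans (cong node eq) (strictlyInverseˡ _)))
  portGraph .irreflexive (p , eq) =
    edge-irreflexive (p , trans (sym (strictlyInverseˡ _)) (cong node eq))
  portGraph .symmetric {u} {w} (p , eq) =
    subst (Fin ∘ degree) arrive (proj₂ e) ,
    trans (cong (name ∘ proj₁ ∘ opposite) (rebase e arrive))
      (trans (cong (name ∘ proj₁) (opposite-involutive (node u , p))) (strictlyInverseʳ u))
    where
    e = opposite (node u , p)
    arrive : proj₁ e ≡ node w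
    arrive = trans (sym (strictlyInverseˡ _)) (cong node eq)
  portGraph .connected u w =
    subst₂ (Star _) (strictlyInverseʳ u) (strictlyInverseʳ w)
      (gmap name lift (edge-connected (node u) (node w)))
    where
    lift : ∀ {v v′} → Edge v v′ → Adj portGraph (name v) (name v′)
    lift {v} (p , refl) =
      subst (Fin ∘ degree) (sym (strictlyInverseˡ v)) p ,
      cong (name ∘ proj₁ ∘ opposite) (rebase (v , p) (sym (strictlyInverseˡ v)))

  -- The arrival port of `portGraph` is the port of the opposite dart, transported along a renaming
  -- of its node. `rebase` undoes that transport, so the agent observes exactly what `opposite`
  -- prescribes.
  node-backPort : ∀ v p →
    (node (nbr portGraph v p) , backPort portGraph v p) ≡ opposite (node v , p)
  node-backPort v p = rebase (opposite (node v , p)) _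

-- The agent's walk does not depend on how the nodes are named by Fin n, so it
-- is followed on V itself.
module Walk {V : Set} (R : RotationSystem V) (B : ∀ {d} → History d → Maybe (Fin d)) where
  open RotationSystem R

  View : Set
  View = Σ V (History ∘ degree)

  arrival : ∀ {d} → History d → Fin d → Dart → View
  arrival h p (w , q) = w , step h p (degree w) q

  move : (c : View) → Maybe (Fin (degree (proj₁ c))) → View
  move c       nothing  = c
  move (v , h) (just p) = arrival h p (opposite (v , p))

  walk : V → ℕ → View
  walk v zero    = v , start (degree v)
  walk v (suc k) = move (walk v k) (B (proj₂ (walk v k)))

module _ {V : Set} {n : ℕ} (Fin↔V : Fin n ↔ V) (R : RotationSystem V)
         (A : Algorithm) (s : Advice) where
  open Inverse Fin↔V using (strictlyInverseˡ) renaming (to to node; from to name)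
  open RotationSystem R
  open Walk R (A s)

  private
    G : PortGraph n
    G = portGraph Fin↔V R

    view : Config A s G → View
    view (u , h) = node u , h

    view-act : ∀ c r → view (act A s G c r) ≡ move (view c) r
    view-act c       nothing  = refl
    view-act (u , h) (just p) = cong (arrival h p) (node-backPort Fin↔V R u p)

    view-config : ∀ v k → view (config A s G (name v) k) ≡ walk v k
    view-config v zero    = cong (λ w → w , start (degree w)) (strictlyInverseˡ v)
    view-config v (suc k) = trans (view-act c (A s (proj₂ c)))
      (cong (λ c′ → move c′ (A s (proj₂ c′))) (view-config v k))
      where c = config A s G (name v) k

  node-position : ∀ v k → node (position A s G (name v) k) ≡ proj₁ (walk v k)
  node-position v k = cong proj₁ (view-config v k)

-- The hard graphs: complete bipartite with subdivided edges.

Node : ℕ → Set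
Node m = Fin 3 × Fin m

pattern left i   = 0F , i
pattern right j  = 1F , j
pattern middle i = 2F , i

valency : ∀ {m} → Node m → ℕ
valency {m} (left _)   = m
valency {m} (right _)  = m
valency     (middle _) = 2

-- The complete bipartite graph K_{m,m} in which, for every i, the edge between
-- left i and right (x i) is subdivided by the node middle i.
module Subdivision {m : ℕ} (x : Fin m → Fin m) where

  NodeDart : Set
  NodeDart = Σ (Node m) (Fin ∘ valency)

  -- Port `j` at `left i` and port `i` at `right j` belong to the same edge of K_{m,m}, and
  -- subdividing that edge keeps both port numbers. Hence degrees and ports at left and right nodes
  -- do not depend on `x`.
  swap : NodeDart → NodeDart
  swap (left i , j) with x i ≟ j
  ... | yes _ = middle i , 0F
  ... | no  _ = right j , i
  swap (right j , i) with x i ≟ j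
  ... | yes _ = middle i , 1F
  ... | no  _ = left i , j
  swap (middle i , 0F) = left i , x i
  swap (middle i , 1F) = right (x i) , i

  swap-involutive : ∀ e → swap (swap e) ≡ e
  swap-involutive (left i , j) with x i ≟ j
  ... | yes refl = refl
  ... | no x≢j with x i ≟ j
  ...   | yes x≡j = contradiction x≡j x≢j
  ...   | no _    = refl
  swap-involutive (right j , i) with x i ≟ j
  ... | yes refl = refl
  ... | no x≢j with x i ≟ j
  ...   | yes x≡j = contradiction x≡j x≢j
  ...   | no _    = refl
  swap-involutive (middle i , 0F) with x i ≟ x i
  ... | yes _  = refl
  ... | no x≢x = contradiction refl x≢x
  swap-involutive (middle i , 1F) with x i ≟ x i
  ... | yes _  = refl
  ... | no x≢x = contradiction refl x≢x

  swap-node-injective : ∀ v → Injective _≡_ _≡_ (λ p → proj₁ (swap (v , p)))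
  swap-node-injective (left i) {j} {j′} eq with x i ≟ j | x i ≟ j′
  swap-node-injective (left i) eq   | yes x≡j | yes x≡j′ = trans (sym x≡j) x≡j′
  swap-node-injective (left i) ()   | yes _   | no _
  swap-node-injective (left i) ()   | no _    | yes _
  swap-node-injective (left i) refl | no _    | no _     = refl
  swap-node-injective (right j) {i} {i′} eq with x i ≟ j | x i′ ≟ j
  swap-node-injective (right j) refl | yes _ | yes _ = refl
  swap-node-injective (right j) ()   | yes _ | no _
  swap-node-injective (right j) ()   | no _  | yes _
  swap-node-injective (right j) refl | no _  | no _  = refl
  swap-node-injective (middle i) {0F} {0F} _  = refl
  swap-node-injective (middle i) {0F} {1F} ()
  swap-node-injective (middle i) {1F} {0F} ()
  swap-node-injective (middle i) {1F} {1F} _  = refl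

  Joined : Node m → Node m → Set
  Joined v w = ∃[ p ] proj₁ (swap (v , p)) ≡ w

  joined-irreflexive : ∀ {v} → ¬ Joined v v
  joined-irreflexive {left i} (j , eq) with x i ≟ j
  joined-irreflexive {left i} (j , ()) | yes _
  joined-irreflexive {left i} (j , ()) | no _
  joined-irreflexive {right j} (i , eq) with x i ≟ j
  joined-irreflexive {right j} (i , ()) | yes _
  joined-irreflexive {right j} (i , ()) | no _
  joined-irreflexive {middle i} (0F , ())
  joined-irreflexive {middle i} (1F , ())

  joined-symmetric : Symmetric Joined
  joined-symmetric {v} (p , refl) = proj₂ (swap (v , p)) , cong proj₁ (swap-involutive (v , p))

  swap-unsubdivided : ∀ {i j} → x i ≢ j → swap (left i , j) ≡ (right j , i)
  swap-unsubdivided {i} {j} x≢j with x i ≟ j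
  ... | yes x≡j = contradiction x≡j x≢j
  ... | no _    = refl

  left⇝right : ∀ i j → Star Joined (left i) (right j)
  left⇝right i j with x i ≟ j
  ... | yes refl = joined-symmetric (0F , refl) ◅ (1F , refl) ◅ ε
  ... | no x≢j   = (j , cong proj₁ (swap-unsubdivided x≢j)) ◅ ε

  joined-connected : ∀ v w → Star Joined v w
  joined-connected v w = to-hub v ◅◅ reverse joined-symmetric (to-hub w)
    where
    hub : Fin m
    -- Since `m` may be 0, the index of the common right node is taken from `v`.
    hub = proj₂ v

    to-hub : ∀ u → Star Joined u (right hub)
    to-hub (left i)   = left⇝right i hub
    to-hub (right j)  = reverse joined-symmetric (left⇝right hub j) ◅◅ left⇝right hub hub
    to-hub (middle i) = (0F , refl) ◅ left⇝right i hub

  subdivision : RotationSystem (Node m)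
  subdivision = record
    { degree              = valency
    ; opposite            = swap
    ; opposite-involutive = swap-involutive
    ; neighbour-injective = swap-node-injective
    ; edge-irreflexive    = joined-irreflexive
    ; edge-connected      = joined-connected
    }

open Subdivision using (swap; swap-involutive; subdivision)

Code : ℕ → Set
Code m = Fin m → Fin m

subdivisionGraph : ∀ {m} → Code m → PortGraph (3 * m)
subdivisionGraph x = portGraph *↔× (subdivision x)

-- What a traversal reveals about the code.

-- `S` holds the indices of the middle nodes found so far. Left and right nodes count as known from
-- the start, being the same for every code.
fresh : ∀ {m} → Subset m → Node m → Bool
fresh S (left _)   = false
fresh S (right _)  = false
fresh S (middle i) = not (lookup S i)

mark : ∀ {m} → Subset m → Node m → Subset m
mark S (left _)   = S
mark S (right _)  = S
mark S (middle i) = S [ i ]≔ inside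

mark-fresh : ∀ {m} (S : Subset m) v → fresh (mark S v) v ≡ false
mark-fresh S (left _)   = refl
mark-fresh S (right _)  = refl
mark-fresh S (middle i) = cong not (lookup∘update i S inside)

mark-monotone : ∀ {m} (S : Subset m) v w → fresh S w ≡ false → fresh (mark S v) w ≡ false
mark-monotone S v          (left _)   _  = refl
mark-monotone S v          (right _)  _  = refl
mark-monotone S (left _)   (middle i) eq = eq
mark-monotone S (right _)  (middle i) eq = eq
mark-monotone S (middle j) (middle i) eq with i ≟ j
... | yes refl = mark-fresh S (middle i)
... | no i≢j   = trans (cong not (lookup∘update′ i≢j S inside)) eq

-- Putting the bit in front of `S` adds one exactly when `i` is new; in this form the count matches
-- the cons in `discoveries`.
∣update∣ : ∀ {m} (S : Subset m) i → ∣ S [ i ]≔ inside ∣ ≡ ∣ not (lookup S i) ∷ S ∣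
∣update∣ (inside  ∷ S) zero    = refl
∣update∣ (outside ∷ S) zero    = refl
∣update∣ (outside ∷ S) (suc i) = ∣update∣ S i
∣update∣ (inside  ∷ S) (suc i) with lookup S i | ∣update∣ S i
... | true  | eq = cong suc eq
... | false | eq = cong suc eq

∣mark∣ : ∀ {m} (S : Subset m) v → ∣ mark S v ∣ ≡ ∣ fresh S v ∷ S ∣
∣mark∣ S (left _)   = refl
∣mark∣ S (right _)  = refl
∣mark∣ S (middle i) = ∣update∣ S i

Agree : ∀ {m} → Subset m → Code m → Code m → Set
Agree S x y = ∀ i → fresh S (middle i) ≡ false → x i ≡ y i

mark-agree : ∀ {m} {S : Subset m} {x y} v → Agree S x y →
             (∀ i → v ≡ middle i → x i ≡ y i) → Agree (mark S v) x y
mark-agree (left _)       agree _   = agree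
mark-agree (right _)      agree _   = agree
mark-agree {S = S} (middle j) agree new i eq with i ≟ j
... | yes refl = new i refl
... | no i≢j   = agree i (trans (cong not (sym (lookup∘update′ i≢j S inside))) eq)

-- Whether a traversal of an edge of K_{m,m} discovers a middle node is the only
-- information about the code that it yields.
swap-agree : ∀ {m} {S : Subset m} {x y} → Agree S x y → ∀ v p → fresh S v ≡ false →
             fresh S (proj₁ (swap x (v , p))) ≡ fresh S (proj₁ (swap y (v , p))) →
             swap x (v , p) ≡ swap y (v , p)
swap-agree {x = x} {y} agree (left i) j _ eq with x i ≟ j | y i ≟ j
... | yes _   | yes _   = refl
... | no _    | no _    = refl
-- If only one code subdivides the edge, the other side ends at a node that is never fresh. Then
-- `eq` says that `middle i` was already found, where the codes agree.
... | yes x≡j | no y≢j  = contradiction (trans (sym (agree i eq)) x≡j) y≢j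
... | no x≢j  | yes y≡j = contradiction (trans (agree i (sym eq)) y≡j) x≢j
swap-agree {x = x} {y} agree (right j) i _ eq with x i ≟ j | y i ≟ j
... | yes _   | yes _   = refl
... | no _    | no _    = refl
... | yes x≡j | no y≢j  = contradiction (trans (sym (agree i eq)) x≡j) y≢j
... | no x≢j  | yes y≡j = contradiction (trans (agree i (sym eq)) y≡j) x≢j
swap-agree agree (middle i) 0F known _ rewrite agree i known = refl
swap-agree agree (middle i) 1F known _ rewrite agree i known = refl

-- By involutivity, both codes send the common dart at `middle i` back to `e`. The dart opposite to
-- one at `middle i` contains the code value at `i`, as a port or as a right node, and `target`
-- extracts it.
swap-middle : ∀ {m} (x y : Code m) e {i} → swap x e ≡ swap y e →
              proj₁ (swap x e) ≡ middle i → x i ≡ y i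
swap-middle {m} x y e {i} same = from-swap (swap x e) refl
  where
  target : Σ (Node m) (Fin ∘ valency) → Fin m
  target (left _   , j) = j
  target (right j  , _) = j
  target (middle i , _) = i

  source : ∀ q → swap x (middle i , q) ≡ swap y (middle i , q) → x i ≡ y i
  source 0F = cong target
  source 1F = cong target

  from-swap : ∀ e′ → swap x e ≡ e′ → proj₁ e′ ≡ middle i → x i ≡ y i
  from-swap (_ , q) eq refl = source q (trans (sym (pull x eq)) (pull y (trans (sym same) eq)))
    where
    pull : ∀ z → swap z e ≡ (middle i , q) → e ≡ swap z (middle i , q)
    pull z eq′ = trans (sym (swap-involutive z e)) (cong (swap z) eq′)

-- Discovery times determine the walk and the code.

module Search {m : ℕ} (hub : Fin m) (B : ∀ {d} → History d → Maybe (Fin d)) where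
  module W (x : Code m) = Walk (subdivision x) B

  View : Set
  View = Σ (Node m) (History ∘ valency)

  visit : Code m → ℕ → Node m
  visit x k = proj₁ (W.walk x (left hub) k)

  seen : Code m → ℕ → Subset m
  seen x zero    = ⊥
  seen x (suc k) = mark (seen x k) (visit x (suc k))

  -- The characteristic vector of the discovery times, latest step first. As `Subset T` is
  -- `Vec Bool T`, the function `∣_∣` counts the discoveries.
  discoveries : Code m → (T : ℕ) → Vec Bool T
  discoveries x zero    = []
  discoveries x (suc k) = fresh (seen x k) (visit x (suc k)) ∷ discoveries x k

  current-seen : ∀ x k → fresh (seen x k) (visit x k) ≡ false
  current-seen x zero    = refl
  current-seen x (suc k) = mark-fresh (seen x k) (visit x (suc k))

  visited-seen : ∀ x {k T} → k ≤′ T → fresh (seen x T) (visit x k) ≡ false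
  visited-seen x {k} ≤′-refl = current-seen x k
  visited-seen x {k} (≤′-step {n = T} k≤T) =
    mark-monotone (seen x T) (visit x (suc T)) (visit x k) (visited-seen x k≤T)

  ∣discoveries∣ : ∀ x k → ∣ discoveries x k ∣ ≡ ∣ seen x k ∣
  ∣discoveries∣ x zero    = sym (∣⊥∣≡0 m)
  ∣discoveries∣ x (suc k) =
    trans (∣∷∣-cong (fresh (seen x k) (visit x (suc k))))
          (sym (∣mark∣ (seen x k) (visit x (suc k))))
    where
    ∣∷∣-cong : ∀ b → ∣ b ∷ discoveries x k ∣ ≡ ∣ b ∷ seen x k ∣
    ∣∷∣-cong inside  = cong suc (∣discoveries∣ x k)
    ∣∷∣-cong outside = ∣discoveries∣ x k

  move-agree : ∀ {x y S} (c : View) r → Agree S x y → fresh S (proj₁ c) ≡ false →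
    fresh S (proj₁ (W.move x c r)) ≡ fresh S (proj₁ (W.move y c r)) →
    W.move x c r ≡ W.move y c r × Agree (mark S (proj₁ (W.move x c r))) x y
  move-agree {x} {y} {S} (v , h) nothing agree known _ =
    refl , mark-agree {S = S} {x} {y} v agree (λ { i refl → agree i known })
  move-agree {x} {y} {S} (v , h) (just p) agree known eq =
    cong (W.arrival x h p) same ,
    mark-agree {S = S} {x} {y} (proj₁ (swap x (v , p))) agree (λ i → swap-middle x y (v , p) same)
    where same = swap-agree {S = S} {x} {y} agree v p known eq

  -- Induction on `k`: equal walks carry equal histories, so the agent takes the same port. The next
  -- bit then fixes the dart reached by `swap-agree`, and a newly found middle node reveals its code
  -- value by `swap-middle`.
  discoveries-agree : ∀ x y k → discoveries x k ≡ discoveries y k →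
    W.walk x (left hub) k ≡ W.walk y (left hub) k × seen x k ≡ seen y k × Agree (seen x k) x y
  discoveries-agree x y zero    _  = refl , refl , λ i eq →
    contradiction (trans (sym (cong not (lookup-replicate i outside))) eq) λ ()
  discoveries-agree x y (suc k) eq
    with discoveries-agree x y k (∷-injectiveʳ eq)
  ... | sameWalk , sameSeen , agree =
    sameWalk′ , cong₂ mark sameSeen (cong proj₁ sameWalk′) , proj₂ next
    where
    c = W.walk x (left hub) k

    y-moves : W.move y c (B (proj₂ c)) ≡ W.walk y (left hub) (suc k)
    y-moves = cong (λ c′ → W.move y c′ (B (proj₂ c′))) sameWalk

    next = move-agree {x} {y} c (B (proj₂ c)) agree (current-seen x k)
      (trans (∷-injectiveˡ eq)
             (cong₂ fresh (sym sameSeen) (cong proj₁ (sym y-moves))))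

    sameWalk′ : W.walk x (left hub) (suc k) ≡ W.walk y (left hub) (suc k)
    sameWalk′ = trans (proj₁ next) y-moves

  Complete : Code m → ℕ → Set
  Complete x T = ∀ i → fresh (seen x T) (middle i) ≡ false

  discoveries-injective : ∀ {x y} T → Complete x T →
                          discoveries x T ≡ discoveries y T → x ≗ y
  discoveries-injective {x} {y} T complete eq i =
    proj₂ (proj₂ (discoveries-agree x y T eq)) i (complete i)

module _ {m : ℕ} (hub : Fin m) (A : Algorithm) (s : Advice) (x : Code m) where
  open Inverse (*↔× {3} {m}) using () renaming (to to node; from to name)
  open Search hub (A s)

  -- What has been seen stays seen, so every exploration time up to `T` is tested at the single time
  -- `T`.
  visitsAll⇒complete : ∀ {t T} → t ≤ T →
    VisitsAllBy A s (subdivisionGraph x) (name (left hub)) t → Complete x T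
  visitsAll⇒complete {t} {T} t≤T visits i with visits (name (middle i))
  ... | k , k≤t , eq = subst (λ v → fresh (seen x T) v ≡ false) at-middle
                             (visited-seen x (≤⇒≤′ (≤-trans k≤t t≤T)))
    where
    at-middle : visit x k ≡ middle i
    at-middle = trans (sym (node-position *↔× (subdivision x) A s (left hub) k))
      (trans (cong node eq) (Inverse.strictlyInverseˡ (*↔× {3} {m}) (middle i)))

-- Counting advice strings and sets of discovery times.

bitstrings : ℕ → List Advice
bitstrings zero    = [] ∷ []
bitstrings (suc b) = [] ∷ List.map (false ∷_) (bitstrings b) ++ List.map (true ∷_) (bitstrings b)

∈-bitstrings : ∀ {b} s → length s ≤ b → s ∈ bitstrings b
∈-bitstrings {zero}  []          _         = here refl
∈-bitstrings {suc b} []          _         = here refl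
∈-bitstrings {suc b} (false ∷ s) (s≤s s≤b) = there (∈-++⁺ˡ (∈-map⁺ _ (∈-bitstrings s s≤b)))
∈-bitstrings {suc b} (true ∷ s)  (s≤s s≤b) =
  there (∈-++⁺ʳ (List.map (false ∷_) (bitstrings b)) (∈-map⁺ _ (∈-bitstrings s s≤b)))

length-map-++-map : ∀ {X Y Z : Set} (g : X → Z) (h : Y → Z) xs ys →
                    length (List.map g xs ++ List.map h ys) ≡ length xs + length ys
length-map-++-map g h xs ys =
  trans (length-++ (List.map g xs)) (cong₂ _+_ (length-map g xs) (length-map h ys))

-- The recursion is `l ↦ 1 + 2 * l`. The `suc` on the left yields the strict inequality in
-- `few-codes`.
length-bitstrings : ∀ b → suc (length (bitstrings b)) ≡ 2 ^ suc b
length-bitstrings zero    = refl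
length-bitstrings (suc b) =
  trans (cong (λ l → suc (suc l)) (length-map-++-map (false ∷_) (true ∷_) (bitstrings b) (bitstrings b)))
    (trans (double (length (bitstrings b))) (cong (2 *_) (length-bitstrings b)))
  where
  double : ∀ l → suc (suc (l + l)) ≡ 2 * suc l
  double = solve-∀

-- The subsets with at most `r` elements, listed by Pascal's rule; the length is a partial sum of
-- binomial coefficients.
sparse : (T r : ℕ) → List (Subset T)
sparse zero    r       = [] ∷ []
sparse (suc T) zero    = List.map (outside ∷_) (sparse T zero)
sparse (suc T) (suc r) = List.map (outside ∷_) (sparse T (suc r)) ++ List.map (inside ∷_) (sparse T r)

∈-sparse : ∀ {T r} (S : Subset T) → ∣ S ∣ ≤ r → S ∈ sparse T r
∈-sparse             []            _         = here refl
∈-sparse {r = zero}  (outside ∷ S) S≤r       = ∈-map⁺ _ (∈-sparse S S≤r)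
∈-sparse {r = suc r} (outside ∷ S) S≤r       = ∈-++⁺ˡ (∈-map⁺ _ (∈-sparse S S≤r))
∈-sparse {suc T} {suc r} (inside ∷ S) (s≤s S≤r) =
  ∈-++⁺ʳ (List.map (outside ∷_) (sparse T (suc r))) (∈-map⁺ _ (∈-sparse S S≤r))

-- Weigh a set S by a ^ (T ∸ ∣ S ∣): all subsets of Fin T together weigh (1 + a) ^ T,
-- and each of those counted here at least a ^ (T ∸ r).
length-sparse : ∀ a .{{_ : NonZero a}} T r →
                length (sparse T r) * a ^ T ≤ a ^ r * suc a ^ T
length-sparse a zero    r = *-monoˡ-≤ 1 (m^n>0 a r)
length-sparse a (suc T) zero = begin
  length (List.map (outside ∷_) (sparse T zero)) * (a * a ^ T)
                              ≡⟨ cong (_* (a * a ^ T)) (length-map (outside ∷_) (sparse T zero)) ⟩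
  l * (a * a ^ T)             ≡⟨ swap₁ l a (a ^ T) ⟩
  a * (l * a ^ T)             ≤⟨ *-mono-≤ (n≤1+n a) (length-sparse a T zero) ⟩
  suc a * (1 * suc a ^ T)     ≡⟨ swap₁ (suc a) 1 (suc a ^ T) ⟩
  1 * (suc a * suc a ^ T)     ∎
  where
  open ≤-Reasoning
  l = length (sparse T zero)
  swap₁ : ∀ x y z → x * (y * z) ≡ y * (x * z)
  swap₁ = solve-∀
length-sparse a (suc T) (suc r) = begin
  length (sparse (suc T) (suc r)) * (a * a ^ T)
    ≡⟨ cong (_* (a * a ^ T)) (length-map-++-map (outside ∷_) (inside ∷_) (sparse T (suc r)) (sparse T r)) ⟩
  (l + l′) * (a * a ^ T)                                  ≡⟨ split l l′ a (a ^ T) ⟩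
  a * (l * a ^ T) + a * (l′ * a ^ T)                      ≤⟨ +-mono-≤
    (*-monoʳ-≤ a (length-sparse a T (suc r))) (*-monoʳ-≤ a (length-sparse a T r)) ⟩
  a * ((a * a ^ r) * suc a ^ T) + a * (a ^ r * suc a ^ T) ≡⟨ merge a (a ^ r) (suc a ^ T) ⟩
  (a * a ^ r) * (suc a * suc a ^ T)                       ∎
  where
  open ≤-Reasoning
  l  = length (sparse T (suc r))
  l′ = length (sparse T r)
  split : ∀ x y z w → (x + y) * (z * w) ≡ z * (x * w) + z * (y * w)
  split = solve-∀
  merge : ∀ a u w → a * ((a * u) * w) + a * (u * w) ≡ (a * u) * (suc a * w)
  merge = solve-∀

*-^-distrib : ∀ a b k → (a * b) ^ k ≡ a ^ k * b ^ k
*-^-distrib a b zero    = refl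
*-^-distrib a b (suc k) = trans (cong (a * b *_) (*-^-distrib a b k)) (*-interchange a b (a ^ k) (b ^ k))
  where
  *-interchange : ∀ a b u v → a * b * (u * v) ≡ a * u * (b * v)
  *-interchange = solve-∀

-- With a = k + b this is (1 + 1/a)^k ≤ a / (a ∸ k).
power-ratio : ∀ k b → suc (k + b) ^ k * b ≤ (k + b) ^ suc k
power-ratio zero    b = ≤-reflexive (trans (*-identityˡ b) (sym (*-identityʳ b)))
power-ratio (suc k) b = begin
  suc a * suc a ^ k * b   ≡⟨ shuffle (suc a) (suc a ^ k) b ⟩
  suc a ^ k * (b + a * b) ≤⟨ *-monoʳ-≤ (suc a ^ k) (+-monoˡ-≤ (a * b) (m≤n+m b (suc k))) ⟩
  suc a ^ k * (a + a * b) ≡⟨ factor (suc a ^ k) a b ⟩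
  suc a ^ k * suc b * a   ≤⟨ *-monoˡ-≤ a hypothesis ⟩
  a ^ suc k * a           ≡⟨ *-comm (a ^ suc k) a ⟩
  a ^ suc (suc k)         ∎
  where
  open ≤-Reasoning
  a = suc (k + b)
  hypothesis : suc a ^ k * suc b ≤ a ^ suc k
  -- The induction keeps `a` fixed: lowering `k` by one raises `b` by one.
  hypothesis = subst (λ a′ → suc a′ ^ k * suc b ≤ a′ ^ suc k) (+-suc k b) (power-ratio k (suc b))
  shuffle : ∀ s u b → s * u * b ≡ u * (s * b)
  shuffle = solve-∀
  factor : ∀ u a b → u * (a + a * b) ≡ u * suc b * a
  factor = solve-∀

suc[2q]^q≤2*[2q]^q : ∀ q .{{_ : NonZero q}} → suc (2 * q) ^ q ≤ 2 * (2 * q) ^ q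
suc[2q]^q≤2*[2q]^q q = *-cancelʳ-≤ _ _ q (begin
  suc (2 * q) ^ q * q        ≡⟨ cong (λ a → suc a ^ q * q) (2*q q) ⟩
  suc (q + q) ^ q * q        ≤⟨ power-ratio q q ⟩
  (q + q) * (q + q) ^ q      ≡⟨ cong (λ a → a * a ^ q) (2*q q) ⟨
  2 * q * (2 * q) ^ q        ≡⟨ shuffle q ((2 * q) ^ q) ⟩
  2 * (2 * q) ^ q * q        ∎)
  where
  open ≤-Reasoning
  2*q : ∀ q → 2 * q ≡ q + q
  2*q = solve-∀
  shuffle : ∀ q u → 2 * q * u ≡ 2 * u * q
  shuffle = solve-∀

-- The weight `a = 2 * q` makes `(1 + 1/a) ^ q` at most 2. Over `q * r` time steps this costs a
-- factor `2 ^ r`, next to the `a ^ r` of `length-sparse`.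
length-sparse-≤ : ∀ q .{{_ : NonZero q}} r → length (sparse (q * r) r) ≤ (4 * q) ^ r
length-sparse-≤ q@(suc _) r = *-cancelʳ-≤ _ _ (a ^ (q * r)) {{m^n≢0 a (q * r)}} (begin
  length (sparse (q * r) r) * a ^ (q * r) ≤⟨ length-sparse a (q * r) r ⟩
  a ^ r * suc a ^ (q * r)                 ≡⟨ cong (a ^ r *_) (^-*-assoc (suc a) q r) ⟨
  a ^ r * (suc a ^ q) ^ r                 ≤⟨ *-monoʳ-≤ (a ^ r) (^-monoˡ-≤ r (suc[2q]^q≤2*[2q]^q q)) ⟩
  a ^ r * (2 * a ^ q) ^ r                 ≡⟨ cong (a ^ r *_) (*-^-distrib 2 (a ^ q) r) ⟩
  a ^ r * (2 ^ r * (a ^ q) ^ r)           ≡⟨ cong (λ u → a ^ r * (2 ^ r * u)) (^-*-assoc a q r) ⟩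
  a ^ r * (2 ^ r * a ^ (q * r))           ≡⟨ rotate (a ^ r) (2 ^ r) (a ^ (q * r)) ⟩
  2 ^ r * a ^ r * a ^ (q * r)             ≡⟨ cong (_* a ^ (q * r)) (*-^-distrib 2 a r) ⟨
  (2 * a) ^ r * a ^ (q * r)               ≡⟨ cong (λ c → c ^ r * a ^ (q * r)) (*-assoc 2 2 q) ⟨
  (4 * q) ^ r * a ^ (q * r)               ∎)
  where
  open ≤-Reasoning
  a = 2 * q
  rotate : ∀ x y z → x * (y * z) ≡ y * x * z
  rotate = solve-∀

few-codes : ∀ k q .{{_ : NonZero q}} m .{{_ : NonZero m}} → 8 * 2 ^ k * q ≤ m →
            length (bitstrings (m * k)) * length (sparse (q * m) m) < m ^ m
few-codes k q@(suc _) m@(suc m-1) small = begin-strict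
  length (bitstrings (m * k)) * length (sparse (q * m) m)
    ≤⟨ *-monoʳ-≤ (length (bitstrings (m * k))) (length-sparse-≤ q m) ⟩
  length (bitstrings (m * k)) * (4 * q) ^ m
    <⟨ *-monoˡ-< ((4 * q) ^ m) {{m^n≢0 (4 * q) m}} (≤-reflexive (length-bitstrings (m * k))) ⟩
  2 * 2 ^ (m * k) * (4 * q) ^ m
    ≡⟨ cong (λ e → 2 * 2 ^ e * (4 * q) ^ m) (*-comm m k) ⟩
  2 * 2 ^ (k * m) * (4 * q) ^ m
    -- As `m` is positive, the single factor 2 from the advice strings is at most `2 ^ m`. All
    -- factors are now `m`-th powers, with base `2 * 2 ^ k * (4 * q)`, whence the 8.
    ≤⟨ *-monoˡ-≤ ((4 * q) ^ m) (*-monoˡ-≤ (2 ^ (k * m)) (^-monoʳ-≤ 2 (s≤s (z≤n {m-1})))) ⟩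
  2 ^ m * 2 ^ (k * m) * (4 * q) ^ m
    ≡⟨ cong (λ u → 2 ^ m * u * (4 * q) ^ m) (^-*-assoc 2 k m) ⟨
  2 ^ m * (2 ^ k) ^ m * (4 * q) ^ m
    ≡⟨ cong (_* (4 * q) ^ m) (*-^-distrib 2 (2 ^ k) m) ⟨
  (2 * 2 ^ k) ^ m * (4 * q) ^ m
    ≡⟨ *-^-distrib (2 * 2 ^ k) (4 * q) m ⟨
  (2 * 2 ^ k * (4 * q)) ^ m
    ≡⟨ cong (_^ m) (regroup (2 ^ k) q) ⟩
  (8 * 2 ^ k * q) ^ m
    ≤⟨ ^-monoˡ-≤ m small ⟩
  m ^ m ∎
  where
  open ≤-Reasoning
  regroup : ∀ u q → 2 * u * (4 * q) ≡ 8 * u * q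
  regroup = solve-∀

-- Pigeonhole: a code that defeats the agent.

-- Codes can only be compared pointwise; numbering them by `Fin (m ^ m)` turns this into the
-- equality that counting requires.
finToFun-injective : ∀ {m n} {i j : Fin (m ^ n)} → finToFun {m} {n} i ≗ finToFun j → i ≡ j
finToFun-injective {m} {n} {i} {j} eq =
  trans (sym (funToFin-finToFin {n} i))
    (trans (funToFin-cong eq) (funToFin-finToFin {n} j))
  where
  funToFin-cong : ∀ {n} {f g : Fin n → Fin m} → f ≗ g → funToFin f ≡ funToFin g
  funToFin-cong {zero}  eq = refl
  funToFin-cong {suc n} eq = cong₂ combine (eq zero) (funToFin-cong (eq ∘ suc))

index-injective : ∀ {X : Set} {x y : X} {xs} (p : x ∈ xs) (q : y ∈ xs) → index p ≡ index q → x ≡ y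
index-injective {xs = xs} p q eq =
  trans (lookup-index p) (trans (cong (List.lookup xs) eq) (sym (lookup-index q)))

-- Choosing a visiting time for each node is injective, since the agent is at one node at a time;
-- only the times from 0 to `t` are available.
visitsAll⇒≤ : ∀ {n} A s (G : PortGraph n) v {t} → VisitsAllBy A s G v t → n ≤ suc t
visitsAll⇒≤ A s G v visits = injective⇒≤ {f = λ w → fromℕ< (s≤s (proj₁ (proj₂ (visits w))))}
  λ {w} {w′} eq → trans (sym (proj₂ (proj₂ (visits w))))
    (trans (cong (position A s G v) (fromℕ<-injective _ _ _ _ eq)) (proj₂ (proj₂ (visits w′))))

module _ (f : Oracle) (A : Algorithm) {m : ℕ} (hub : Fin m) where

  hubName : Fin (3 * m)
  hubName = combine {3} 0F hub

  advice : Code m → Advice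
  advice x = f (subdivisionGraph x) hubName

  VisitsAll : Code m → ℕ → Set
  VisitsAll x = VisitsAllBy A (advice x) (subdivisionGraph x) hubName

  -- Here `x` only fixes the advice. The code walked on is a further argument, so that two codes can
  -- be compared under one advice string.
  module Run (x : Code m) = Search hub (A (advice x))

  complete⇒≤ : ∀ {b} T → (∀ x → length (advice x) ≤ b) →
               (∀ K → Run.Complete (finToFun K) (finToFun K) T) →
               m ^ m ≤ length (bitstrings b) * length (sparse T m)
  complete⇒≤ {b} T short complete = injective⇒≤ encode-injective
    where
    code : Fin (m ^ m) → Code m
    code = finToFun

    transcript : Fin (m ^ m) → Subset T
    transcript K = Run.discoveries (code K) (code K) T

    transcript∈ : ∀ K → transcript K ∈ sparse T m
    transcript∈ K = ∈-sparse (transcript K)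
      (≤-trans (≤-reflexive (Run.∣discoveries∣ (code K) (code K) T)) (∣p∣≤n (Run.seen (code K) (code K) T)))

    advice∈ : ∀ K → advice (code K) ∈ bitstrings b
    advice∈ K = ∈-bitstrings (advice (code K)) (short (code K))

    encode : Fin (m ^ m) → Fin (length (bitstrings b) * length (sparse T m))
    encode K = combine (index (advice∈ K)) (index (transcript∈ K))

    encode-injective : Injective _≡_ _≡_ encode
    encode-injective {K} {K′} eq = finToFun-injective {m} {m}
      (Run.discoveries-injective (code K) T (complete K)
        (trans (index-injective (transcript∈ K) (transcript∈ K′) (proj₂ same))
               -- Equal advice lets the second transcript be read in the `Search` of the first,
               -- where `discoveries-injective` applies.
               (cong (λ s → Search.discoveries hub (A s) (code K′) T) (sym sameAdvice))))
      where
      same = combine-injective (index (advice∈ K)) (index (transcript∈ K)) _ _ eq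
      sameAdvice = index-injective (advice∈ K) (advice∈ K′) (proj₁ same)

  -- If every code were complete at time `q * m`, then `complete⇒≤` would contradict `few-codes`.
  -- Completeness is decidable and there are finitely many codes, so an incomplete one can be
  -- exhibited.
  unexplored : ∀ k q .{{_ : NonZero q}} → 8 * 2 ^ k * q ≤ m →
               (∀ x → length (advice x) ≤ m * k) →
               ∃[ x ] (∀ t → t ≤ q * m → ¬ VisitsAll x t)
  unexplored k q small short =
    finToFun (proj₁ witness) ,
    λ t t≤T visits → proj₂ witness (visitsAll⇒complete hub A _ _ t≤T visits)
    where
    P : Fin (m ^ m) → Set
    P K = Run.Complete (finToFun K) (finToFun K) (q * m)

    witness : ∃[ K ] ¬ P K
    witness = ¬∀⟶∃¬ (m ^ m) P (λ K → all? (λ i → _ Bool.≟ false))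
      (λ complete → <⇒≱ (few-codes k q m {{Fin.nonZeroIndex hub}} small)
                        (complete⇒≤ (q * m) short complete))

  hardCode : ∀ k → (∀ x → length (advice x) ≤ m * k) →
    ∃[ x ] (∀ t → 16 * 2 ^ k * t < m * m → ¬ VisitsAll x t)
  hardCode k short = byQuotient (m / d) refl
    where
    open ≤-Reasoning

    instance
      m≢0 : NonZero m
      m≢0 = Fin.nonZeroIndex hub

      d≢0 : NonZero (8 * 2 ^ k)
      d≢0 = m*n≢0 8 (2 ^ k) {{_}} {{m^n≢0 2 k}}

    d : ℕ
    d = 8 * 2 ^ k

    -- The factor 16 is `2 * d / 2 ^ k`. Rounding `m / d` down replaces the quotient by `suc q`, and
    -- the spare 2 compensates for that in both cases below.
    double-time : ∀ {t q} → m / d ≡ q → 16 * 2 ^ k * t < m * m → 2 * t < m * suc q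
    double-time {t} refl lt = *-cancelˡ-< d _ _ (begin-strict
      d * (2 * t)                       ≡⟨ regroup (2 ^ k) t ⟩
      16 * 2 ^ k * t                    <⟨ lt ⟩
      m * m                             ≡⟨ cong (m *_) (m≡m%n+[m/n]*n m d) ⟩
      m * (m % d + m / d * d)           ≤⟨ *-monoʳ-≤ m (+-monoˡ-≤ _ (m%n≤n m d)) ⟩
      m * (suc (m / d) * d)             ≡⟨ rotate m (suc (m / d)) d ⟩
      d * (m * suc (m / d))             ∎)
      where
      regroup : ∀ D t → 8 * D * (2 * t) ≡ 16 * D * t
      regroup = solve-∀
      rotate : ∀ m s d → m * (s * d) ≡ d * (m * s)
      rotate = solve-∀

    byQuotient : ∀ q → m / d ≡ q → ∃[ x ] (∀ t → 16 * 2 ^ k * t < m * m → ¬ VisitsAll x t)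
    -- For quotient 0 any code will do, here the identity: `2 * t < m` is too short for `3 * m`
    -- nodes.
    byQuotient zero m/d≡0 = (λ i → i) , λ t lt visits → <⇒≱
      (begin-strict
        suc t         ≤⟨ s≤s (m≤m+n t (t + 0)) ⟩
        suc (2 * t)   ≤⟨ double-time {t} m/d≡0 lt ⟩
        m * 1         ≡⟨ *-identityʳ m ⟩
        m             <⟨ m<m+n m (<-≤-trans (n≢0⇒n>0 (≢-nonZero⁻¹ m)) (m≤m+n m (m + 0))) ⟩
        3 * m         ∎)
      (visitsAll⇒≤ A (advice (λ i → i)) (subdivisionGraph {m} (λ i → i)) hubName visits)
    byQuotient q@(suc q-1) m/d≡q = proj₁ hard , λ t lt →
      proj₂ hard t (halve t (double-time {t} m/d≡q lt))
      where
      hard = unexplored k q (begin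
        d * q         ≡⟨ *-comm d q ⟩
        q * d         ≡⟨ cong (_* d) m/d≡q ⟨
        m / d * d     ≤⟨ m/n*n≤m m d ⟩
        m             ∎) short

      halve : ∀ t → 2 * t < m * suc q → t ≤ q * m
      halve t lt = *-cancelˡ-≤ 2 (begin
        2 * t               ≤⟨ <⇒≤ lt ⟩
        -- The quotient is positive, so `1 + q` is at most `2 * q`.
        m * (1 + q)         ≤⟨ *-monoʳ-≤ m (+-monoˡ-≤ q (s≤s (z≤n {q-1}))) ⟩
        m * (q + q)         ≡⟨ rotate m q ⟩
        2 * (q * m)         ∎)
        where
        rotate : ∀ m q → m * (q + q) ≡ 2 * (q * m)
        rotate = solve-∀

-- From rational bounds to natural numbers, and the theorem.

private
  1* : ∀ k → (+ 1 ℤ.* + k) ℤ.* + 1 ≡ + k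
  1* k = trans (ℤ.*-identityʳ _) (ℤ.*-identityˡ _)

≤-third : ∀ l k → fromℕ l ℚᵘ.≤ (+ 1 ℚᵘ./ 3) ℚᵘ.* fromℕ k → l * 3 ≤ k
≤-third l k (ℚᵘ.*≤* le) = ℤ.drop‿+≤+ (subst₂ ℤ._≤_ (sym (ℤ.pos-* l 3)) (1* k) le)

<-scaled : ∀ c .{{_ : NonZero c}} t k d .{{_ : NonZero d}} →
  fromℕ t ℚᵘ.< (+ 1 ℚᵘ./ c) ℚᵘ.* (+ k ℚᵘ./ d) → t * (c * d) < k
<-scaled c@(suc _) t k d@(suc _) (ℚᵘ.*<* lt) =
  ℤ.drop‿+<+ (subst₂ ℤ._<_ (sym (ℤ.pos-* t (c * d))) (1* k) lt)

mainTheorem8 : (φ : ℕ → ℕ) (f : Oracle) → AdviceSize-o f (λ n → n * φ n) →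
    (A : Algorithm) →
    Σ[ c ∈ ℚᵘ ] 0ℚᵘ ℚᵘ.< c ×
    (∀ N → ∃[ n ] N ≤ n × (Σ[ G ∈ PortGraph n ] Σ[ v ∈ Fin n ]
    (∀ t → fromℕ t ℚᵘ.< c ℚᵘ.* ℚᵘ._/_ (+ (n ^ 2)) (2 ^ φ n) {{m^n≢0 2 (φ n)}} →
    ¬ ExploresWithin A (f G v) G v t)))
-- With `n = 3 * m` the square is `9 * m * m`, and 144 is 9 times the 16 of `hardCode`.
mainTheorem8 φ f small A = + 1 ℚᵘ./ 144 , ℚᵘ.*<* (ℤ.+<+ (s≤s z≤n)) , λ N →
  -- This `m` exceeds both thresholds, and being positive it provides `zero` as the index of the
  -- starting node.
  let m = suc (N + N₀)
      x , unvisited = hardCode f A {m} zero (φ (3 * m)) (short m (m≤n⇒m≤1+n (m≤n+m N₀ N)) zero)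
  in 3 * m , ≤-trans (m≤n⇒m≤1+n (m≤m+n N N₀)) (m≤m+n m (2 * m)) ,
     subdivisionGraph x , hubName f A {m} zero , λ t lt explores →
       unvisited t (few-steps m t (2 ^ φ (3 * m)) {{m^n≢0 2 (φ (3 * m))}} lt) (proj₁ explores)
  where
  third-positive : 0ℚᵘ ℚᵘ.< + 1 ℚᵘ./ 3
  third-positive = ℚᵘ.*<* (ℤ.+<+ (s≤s z≤n))

  N₀ : ℕ
  -- A third of `n * φ n` is `m * φ n`, the advice length that `hardCode` allows.
  N₀ = proj₁ (small (+ 1 ℚᵘ./ 3) third-positive)

  short : ∀ m → N₀ ≤ m → (hub : Fin m) (x : Code m) → length (advice f A hub x) ≤ m * φ (3 * m)
  short m N₀≤m hub x = *-cancelʳ-≤ _ _ 3 (≤-trans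
    (≤-third _ _ (proj₂ (small (+ 1 ℚᵘ./ 3) third-positive) (3 * m)
      (≤-trans N₀≤m (m≤m+n m (2 * m))) (subdivisionGraph x) (hubName f A hub)))
    (≤-reflexive (rotate m (φ (3 * m)))))
    where
    rotate : ∀ m k → 3 * m * k ≡ m * k * 3
    rotate = solve-∀

  few-steps : ∀ m t D .{{_ : NonZero D}} →
    fromℕ t ℚᵘ.< (+ 1 ℚᵘ./ 144) ℚᵘ.* (+ ((3 * m) ^ 2) ℚᵘ./ D) → 16 * D * t < m * m
  few-steps m t D lt = *-cancelˡ-< 9 _ _ (begin-strict
    9 * (16 * D * t)    ≡⟨ regroup D t ⟩
    t * (144 * D)       <⟨ <-scaled 144 t ((3 * m) ^ 2) D lt ⟩
    (3 * m) ^ 2         ≡⟨ *-^-distrib 3 m 2 ⟩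
    9 * m ^ 2           ≡⟨ cong (λ u → 9 * (m * u)) (*-identityʳ m) ⟩
    9 * (m * m)         ∎)
    where
    open ≤-Reasoning
    regroup : ∀ D t → 9 * (16 * D * t) ≡ t * (144 * D)
    regroup = solve-∀
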